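{- Let $\ell\ge 8$ and let $\vec C$ be an orientation of the cycle $C_\ell$. If $G$ is a graph with $m(G)<m_2(\vec C)$, then $G\not\to\vec C$, i.e., $G$ has an orientation containing no copy of $\vec C$.
   Context: $m(G)=\max\{e(J)/v(J):J\subseteq G,\ v(J)\ge1\}$ and $m_2(G)=\max\{(e(J)-1)/(v(J)-2):J\subseteq G,\ v(J)\ge3\}$, densities of oriented graphs being those of their underlying graphs (so $m_2(\vec C)=(\ell-1)/(\ell-2)$). -}

module Defs where

open import Data.Nat using (ℕ; zero; suc; _*_; _∸_; _<_; _<ᵇ_)
open import Data.Nat.DivMod using (_%_; m%n<n)
open import Data.Bool using (Bool; true; false; _∧_)
open import Data.Fin using (Fin; toℕ; fromℕ<)
open import Data.Fin.Subset using (Subset; Nonempty; ∣_∣)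
open import Data.Vec using (lookup)
open import Data.List using (List; length; filterᵇ; cartesianProduct; allFin)
open import Data.Product using (Σ; _×_; _,_; proj₁; proj₂)
open import Data.Sum using (_⊎_)
open import Data.Empty using (⊥)
open import Relation.Binary.PropositionalEquality using (_≡_)
open import Relation.Nullary using (¬_)
open import Function.Definitions using (Injective)

record Graph (n : ℕ) : Set where
  field
    Adj    : Fin n → Fin n → Bool
    sym    : ∀ u v → Adj u v ≡ Adj v u
    irrefl : ∀ u → Adj u u ≡ false
open Graph public

edgesIn : ∀ {n} → Graph n → Subset n → ℕ
edgesIn {n} G S =
  length (filterᵇ (λ p → (toℕ (proj₁ p) <ᵇ toℕ (proj₂ p))
                         ∧ lookup S (proj₁ p) ∧ lookup S (proj₂ p)
                         ∧ Adj G (proj₁ p) (proj₂ p))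
                  (cartesianProduct (allFin n) (allFin n)))

-- m(G) < p / q  (q > 0), written out: for every nonempty vertex set S,
-- e(G[S]) / |S| < p / q.  (Maximising over all subgraphs J equals maximising
-- over induced subgraphs, since e(J) ≤ e(G[V(J)]).)
mBelow : ∀ {n} → Graph n → ℕ → ℕ → Set
mBelow {n} G p q = (S : Subset n) → Nonempty S → edgesIn G S * q < p * ∣ S ∣

record Orientation {n : ℕ} (G : Graph n) : Set where
  field
    Arc      : Fin n → Fin n → Bool
    onEdges  : ∀ u v → Arc u v ≡ true → Adj G u v ≡ true
    covers   : ∀ u v → Adj G u v ≡ true → (Arc u v ≡ true) ⊎ (Arc v u ≡ true)
    antisym  : ∀ u v → Arc u v ≡ true → Arc v u ≡ true → ⊥
open Orientation public

next : ∀ {k} → Fin (suc k) → Fin (suc k)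
next {k} i = fromℕ< (m%n<n (suc (toℕ i)) (suc k))

-- An orientation of C_ℓ is given by d : Fin ℓ → Bool;
-- d i = true means the edge {i, i+1} is oriented i → i+1, otherwise i+1 → i.
CycleOrientation : ℕ → Set
CycleOrientation ℓ = Fin ℓ → Bool

CopyOfCycle : ∀ {n k} {G : Graph n} → CycleOrientation (suc k) → Orientation G → Set
CopyOfCycle {n} {k} d O =
  Σ (Fin (suc k) → Fin n) λ φ →
    Injective _≡_ _≡_ φ ×
    (∀ i → ArcDir (d i) (φ i) (φ (next i)))
  where
    ArcDir : Bool → Fin n → Fin n → Set
    ArcDir true  a b = Arc O a b ≡ true
    ArcDir false a b = Arc O b a ≡ true

-- m₂ of an oriented ℓ-cycle (ℓ ≥ 3) equals (ℓ-1)/(ℓ-2) (as given in the context);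
-- numerator and denominator:
m₂num m₂den : ℕ → ℕ
m₂num ℓ = ℓ ∸ 1
m₂den ℓ = ℓ ∸ 2

{-# OPTIONS --safe #-}

-- If some three consecutive edges of the cycle form a directed path, orient G along a proper
-- 3-colouring, so that no directed path has three edges; G is 3-colourable because it is
-- 2-degenerate.  Otherwise a directed path with three edges never occurs in the cycle.  By
-- discharging, every nonempty S ⊆ V(G) induces a graph with a vertex of degree at most 1 or with
-- two adjacent vertices x, y of degree at most 2: if not, let each vertex of degree at least 3
-- send 1/5 along every edge to a neighbour of degree 2; then all degrees become at least 12/5,
-- whereas m(G) < 7/6.  Vertices of the first kind lie on no cycle; pairs of the second kind are
-- oriented ∙ → x → y → ∙, and every cycle through x or y contains this directed path.
module Submission where

open import Defs hiding (sym)
import Algebra.Properties.Semiring.Sum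
open import Data.Bool using (Bool; true; false; _∧_; not; if_then_else_)
import Data.Bool as Bool
open import Data.Bool.Properties using (T-≡; ∧-comm; ∧-assoc; not-involutive)
open import Data.Empty using (⊥)
open import Data.Fin using (Fin; zero; suc; toℕ; fromℕ; inject₁)
open import Data.Fin.Properties using (_≟_; any?; ¬∀⟶∃¬; toℕ-injective; toℕ<n; toℕ-fromℕ; toℕ-fromℕ<; toℕ-inject₁)
open import Data.Fin.Subset using (Subset; Nonempty; ∣_∣; _∈_; _-_; ⊤)
open import Data.Fin.Subset.Properties using (_∈?_; nonempty?; ∈⊤; x∈p∧x≢y⇒x∈p-y; x∈p⇒∣p-x∣<∣p∣; ∣p─q∣≤∣p∣)
open import Data.List using (List; []; _∷_; length; filterᵇ; cartesianProduct; tabulate; allFin; map)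
open import Data.List.Properties using (filter-++; length-++)
open import Data.Nat using (ℕ; zero; suc; _+_; _*_; _∸_; _≤_; _<_; _<ᵇ_; _≤?_; z≤n; s≤s; s≤s⁻¹)
open import Data.Nat.DivMod using (_%_; m%n<n; m<n⇒m%n≡m; n%n≡0)
open import Data.Nat.Induction using (<-wellFounded)
open import Data.Nat.Properties hiding (_≟_)
open import Data.Nat.Tactic.RingSolver using (solve-∀)
open import Data.Product using (Σ; ∃; ∃₂; _×_; _,_; proj₁; proj₂)
open import Data.Sum using (_⊎_; inj₁; inj₂)
import Data.Vec as Vec
open Vec using (lookup; []; _∷_)
open import Data.Vec.Properties using (lookup∘tabulate; lookup⇒[]=; []=⇒lookup)
open import Function using (_∘_; Equivalence)
open import Function.Definitions using (Injective)
open import Induction.WellFounded using (module All)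
import Relation.Binary.Construct.On as On
open import Relation.Binary.PropositionalEquality using (_≡_; _≢_; refl; sym; trans; cong; cong₂; subst; ≢-sym)
open import Relation.Nullary using (¬_; Dec; yes; no; does; contradiction)
open import Relation.Nullary.Decidable using (T?; _×-dec_; dec-true; dec-false; decidable-stable)

open import Algebra.Properties.CommutativeSemigroup *-commutativeSemigroup using (x∙yz≈y∙xz)
open Algebra.Properties.Semiring.Sum +-*-semiring using (sum; sum-cong-≗; ∑-distrib-+; ∑-comm; *-distribˡ-sum; *-distribʳ-sum)

private
  variable
    n k : ℕ
    A B : Set

-- Counting

𝟙 : Bool → ℕ
𝟙 true  = 1
𝟙 false = 0

sum-mono-≤ : {f g : Fin n → ℕ} → (∀ i → f i ≤ g i) → sum f ≤ sum g
sum-mono-≤ {zero}  f≤g = z≤n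
sum-mono-≤ {suc n} f≤g = +-mono-≤ (f≤g zero) (sum-mono-≤ (f≤g ∘ suc))

sum≡0 : {f : Fin n → ℕ} → (∀ i → f i ≡ 0) → sum f ≡ 0
sum≡0 {zero}  f≡0 = refl
sum≡0 {suc n} f≡0 = cong₂ _+_ (f≡0 zero) (sum≡0 (f≡0 ∘ suc))

∣S∣≡sum : (S : Subset n) → ∣ S ∣ ≡ sum (λ i → 𝟙 (lookup S i))
∣S∣≡sum []          = refl
∣S∣≡sum (true ∷ S)  = cong suc (∣S∣≡sum S)
∣S∣≡sum (false ∷ S) = ∣S∣≡sum S

length-filterᵇ-∷ : (f : A → Bool) (x : A) (xs : List A) →
                   length (filterᵇ f (x ∷ xs)) ≡ 𝟙 (f x) + length (filterᵇ f xs)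
length-filterᵇ-∷ f x xs with f x
... | true  = refl
... | false = refl

length-filterᵇ-tabulate : (f : A → Bool) (g : Fin n → A) →
                          length (filterᵇ f (tabulate g)) ≡ sum (λ i → 𝟙 (f (g i)))
length-filterᵇ-tabulate {n = zero}  f g = refl
length-filterᵇ-tabulate {n = suc n} f g =
  trans (length-filterᵇ-∷ f (g zero) _) (cong (𝟙 (f (g zero)) +_) (length-filterᵇ-tabulate f (g ∘ suc)))

length-filterᵇ-map : (f : B → Bool) (h : A → B) (xs : List A) →
                     length (filterᵇ f (map h xs)) ≡ length (filterᵇ (f ∘ h) xs)
length-filterᵇ-map f h []       = refl
length-filterᵇ-map f h (x ∷ xs) =
  trans (length-filterᵇ-∷ f (h x) _)
    (trans (cong (𝟙 (f (h x)) +_) (length-filterᵇ-map f h xs)) (sym (length-filterᵇ-∷ (f ∘ h) x xs)))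

length-filterᵇ-cartesianProduct : (f : A × B → Bool) (g : Fin n → A) (ys : List B) →
  length (filterᵇ f (cartesianProduct (tabulate g) ys)) ≡ sum (λ i → length (filterᵇ (λ y → f (g i , y)) ys))
length-filterᵇ-cartesianProduct {n = zero}  f g ys = refl
length-filterᵇ-cartesianProduct {n = suc n} f g ys =
  trans (cong length (filter-++ (T? ∘ f) (map (g zero ,_) ys) _))
    (trans (length-++ (filterᵇ f (map (g zero ,_) ys)))
      (cong₂ _+_ (length-filterᵇ-map f (g zero ,_) ys) (length-filterᵇ-cartesianProduct f (g ∘ suc) ys)))

-- A strict order selects exactly one direction of each pair of distinct values. The edge count, the
-- orientation by colours and the default orientation by vertex numbers all rest on this.
<ᵇ-flip : ∀ a b → a ≢ b → (b <ᵇ a) ≡ not (a <ᵇ b)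
<ᵇ-flip zero    zero    a≢b = contradiction refl a≢b
<ᵇ-flip zero    (suc b) a≢b = refl
<ᵇ-flip (suc a) zero    a≢b = refl
<ᵇ-flip (suc a) (suc b) a≢b = <ᵇ-flip a b (a≢b ∘ cong suc)

three-members⇒3≤∣p∣ : {p : Subset n} {a b c : Fin n} → a ∈ p → b ∈ p → c ∈ p →
                      a ≢ b → a ≢ c → b ≢ c → 3 ≤ ∣ p ∣
three-members⇒3≤∣p∣ {p = p} {a} {b} {c} a∈ b∈ c∈ a≢b a≢c b≢c =
  ≤-trans (s≤s (≤-trans (s≤s (≤-trans (s≤s z≤n) (x∈p⇒∣p-x∣<∣p∣ c∈″))) (x∈p⇒∣p-x∣<∣p∣ b∈′))) (x∈p⇒∣p-x∣<∣p∣ a∈)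
  where
  b∈′ : b ∈ p - a
  b∈′ = x∈p∧x≢y⇒x∈p-y b∈ (≢-sym a≢b)
  c∈″ : c ∈ (p - a) - b
  c∈″ = x∈p∧x≢y⇒x∈p-y (x∈p∧x≢y⇒x∈p-y c∈ (≢-sym a≢c)) (≢-sym b≢c)

two-members⇒2≤∣p∣ : {p : Subset n} {a b : Fin n} → a ∈ p → b ∈ p → a ≢ b → 2 ≤ ∣ p ∣
two-members⇒2≤∣p∣ {p = p} {a} {b} a∈ b∈ a≢b =
  ≤-trans (s≤s (≤-trans (s≤s z≤n) (x∈p⇒∣p-x∣<∣p∣ (x∈p∧x≢y⇒x∈p-y b∈ (≢-sym a≢b))))) (x∈p⇒∣p-x∣<∣p∣ a∈)

-- Strong induction is needed because one of the reductions deletes two vertices at once.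
∣∣-induction : (P : Subset n → Set) → (∀ S → (∀ S′ → ∣ S′ ∣ < ∣ S ∣ → P S′) → P S) → ∀ S → P S
∣∣-induction P step = All.wfRec (On.wellFounded ∣_∣ <-wellFounded) _ P (λ S rec → step S (λ S′ lt → rec lt))

-- Sparsity gives e/s < k/(k-1) ≤ 7/6, whereas discharging would give e/s ≥ 6/5. After
-- cross-multiplication with k = 7 + j the two bounds clash, with slack 2e(1 + j).
sparse⇒¬discharging : ∀ {e s} → 7 ≤ k → e * (k ∸ 1) < k * s → ¬ (12 * s ≤ (e + e) * 5)
sparse⇒¬discharging {k} {e} {s} 7≤k e[k-1]<ks 12s≤10e with m≤n⇒∃[o]m+o≡n 7≤k
... | j , refl = <⇒≱ (begin-strict
  12 * (e * (6 + j)) <⟨ *-monoʳ-< 12 e[k-1]<ks ⟩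
  12 * ((7 + j) * s) ≡⟨ x∙yz≈y∙xz 12 (7 + j) s ⟩
  (7 + j) * (12 * s) ≤⟨ *-monoʳ-≤ (7 + j) 12s≤10e ⟩
  (7 + j) * ((e + e) * 5) ∎)
  (subst ((7 + j) * ((e + e) * 5) ≤_) (excess e j) (m≤m+n _ (2 * e + 2 * (e * j))))
  where
  open ≤-Reasoning
  excess : ∀ e j → (7 + j) * ((e + e) * 5) + (2 * e + 2 * (e * j)) ≡ 12 * (e * (6 + j))
  excess = solve-∀

-- Degrees in induced subgraphs

module _ (G : Graph n) where

  -- Testing both endpoints gives vertices outside `S` degree 0, so all sums can range over `Fin n`.
  -- The conjunction is the one inside `edgesIn`, which makes `edgesIn≡sum` a mere unfolding.
  adjIn : Subset n → Fin n → Fin n → Bool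
  adjIn S u v = lookup S u ∧ lookup S v ∧ Adj G u v

  nbrs : Subset n → Fin n → Subset n
  nbrs S u = Vec.tabulate (adjIn S u)

  deg : Subset n → Fin n → ℕ
  deg S u = ∣ nbrs S u ∣

  adj⇒≢ : ∀ {u v} → Adj G u v ≡ true → u ≢ v
  adj⇒≢ {u} uv refl with trans (sym uv) (irrefl G u)
  ... | ()

  adj-sym : ∀ {u v} → Adj G u v ≡ true → Adj G v u ≡ true
  adj-sym {u} {v} uv = trans (Graph.sym G v u) uv

  adjIn-sym : ∀ S u v → adjIn S u v ≡ adjIn S v u
  adjIn-sym S u v rewrite Graph.sym G u v =
    trans (sym (∧-assoc (lookup S u) _ _))
      (trans (cong (_∧ Adj G v u) (∧-comm (lookup S u) (lookup S v))) (∧-assoc (lookup S v) _ _))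

  adjIn-irrefl : ∀ S u → adjIn S u u ≡ false
  adjIn-irrefl S u rewrite irrefl G u with lookup S u
  ... | true  = refl
  ... | false = refl

  adjIn⇒ : ∀ S u v → adjIn S u v ≡ true → u ∈ S × v ∈ S × Adj G u v ≡ true
  adjIn⇒ S u v h with lookup S u in eu | lookup S v in ev
  ... | true  | true  = lookup⇒[]= u S eu , lookup⇒[]= v S ev , h
  ... | true  | false = contradiction h λ ()
  ... | false | _     = contradiction h λ ()

  ∈-nbrs : ∀ {S u v} → u ∈ S → v ∈ S → Adj G u v ≡ true → v ∈ nbrs S u
  ∈-nbrs {S} {u} {v} u∈ v∈ uv = lookup⇒[]= v _ (trans (lookup∘tabulate (adjIn S u) v) adjacent)
    where
    adjacent : adjIn S u v ≡ true
    adjacent rewrite []=⇒lookup u∈ | []=⇒lookup v∈ = uv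

  deg≡sum : ∀ S u → deg S u ≡ sum (λ v → 𝟙 (adjIn S u v))
  deg≡sum S u = trans (∣S∣≡sum (nbrs S u)) (sum-cong-≗ (λ v → cong 𝟙 (lookup∘tabulate (adjIn S u) v)))

  edgesIn≡sum : ∀ S → edgesIn G S ≡ sum (λ u → sum (λ v → 𝟙 ((toℕ u <ᵇ toℕ v) ∧ adjIn S u v)))
  edgesIn≡sum S =
    trans (length-filterᵇ-cartesianProduct (λ (u , v) → (toℕ u <ᵇ toℕ v) ∧ adjIn S u v) (λ u → u) (allFin n))
      (sum-cong-≗ (λ u → length-filterᵇ-tabulate (λ v → (toℕ u <ᵇ toℕ v) ∧ adjIn S u v) (λ v → v)))

  -- Each edge at `u` is increasing when read either from `u` or towards `u`, never both. Exchanging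
  -- the order of summation turns the second count into the first.
  handshake : ∀ S → sum (deg S) ≡ edgesIn G S + edgesIn G S
  handshake S = begin
    sum (deg S)                                             ≡⟨ sum-cong-≗ (deg≡sum S) ⟩
    sum (λ u → sum (λ v → 𝟙 (adjIn S u v)))                 ≡⟨ sum-cong-≗ (λ u → sum-cong-≗ (split u)) ⟩
    sum (λ u → sum (λ v → up u v + up v u))                 ≡⟨ sum-cong-≗ (λ u → ∑-distrib-+ (up u) (λ v → up v u)) ⟩
    sum (λ u → sum (up u) + sum (λ v → up v u))             ≡⟨ ∑-distrib-+ (λ u → sum (up u)) (λ u → sum (λ v → up v u)) ⟩
    sum (λ u → sum (up u)) + sum (λ u → sum (λ v → up v u)) ≡⟨ cong (sum (λ u → sum (up u)) +_) (∑-comm (λ u v → up v u)) ⟩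
    sum (λ u → sum (up u)) + sum (λ u → sum (up u))         ≡⟨ cong₂ _+_ (edgesIn≡sum S) (edgesIn≡sum S) ⟨
    edgesIn G S + edgesIn G S                               ∎
    where
    open Relation.Binary.PropositionalEquality.≡-Reasoning
    up : Fin n → Fin n → ℕ
    up u v = 𝟙 ((toℕ u <ᵇ toℕ v) ∧ adjIn S u v)
    split : ∀ u v → 𝟙 (adjIn S u v) ≡ up u v + up v u
    split u v with u ≟ v
    ... | yes refl rewrite adjIn-irrefl S u with toℕ u <ᵇ toℕ u
    ...   | true  = refl
    ...   | false = refl
    split u v | no u≢v
      rewrite adjIn-sym S v u | <ᵇ-flip (toℕ u) (toℕ v) (u≢v ∘ toℕ-injective)
      with toℕ u <ᵇ toℕ v
    ...   | true  = sym (+-identityʳ _)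
    ...   | false = refl

  -- Discharging

  low : Subset n → Fin n → ℕ
  low S u = 𝟙 (does (deg S u ≤? 2))

  low≤1 : ∀ S u → low S u ≤ 1
  low≤1 S u with does (deg S u ≤? 2)
  ... | true  = s≤s z≤n
  ... | false = z≤n

  low≡1 : ∀ S u → deg S u ≤ 2 → low S u ≡ 1
  low≡1 S u d = cong 𝟙 (dec-true (deg S u ≤? 2) d)

  low≡0 : ∀ S u → 2 < deg S u → low S u ≡ 0
  low≡0 S u d = cong 𝟙 (dec-false (deg S u ≤? 2) (<⇒≱ d))

  module _ (S : Subset n) (deg≥2 : ∀ u → u ∈ S → 2 ≤ deg S u)
           (low-independent : ∀ u v → adjIn S u v ≡ true → deg S u ≤ 2 → deg S v ≤ 2 → ⊥) where

    private
      a : Fin n → Fin n → ℕ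
      a u v = 𝟙 (adjIn S u v)

      -- Charge is measured in fifths: a vertex starts with 5 times its degree, passes 1 along each
      -- edge to a low neighbour, and must end with 12.
      sent : Fin n → ℕ
      sent u = sum (λ v → a u v * low S v)

      sent≤deg : ∀ u → sent u ≤ deg S u
      sent≤deg u = ≤-trans
        (sum-mono-≤ (λ v → ≤-trans (*-monoʳ-≤ (a u v) (low≤1 S v)) (≤-reflexive (*-identityʳ (a u v)))))
        (≤-reflexive (sym (deg≡sum S u)))

      sends-nothing : ∀ u → deg S u ≤ 2 → sent u ≡ 0
      sends-nothing u deg≤2 = sum≡0 zero-term
        where
        zero-term : ∀ v → a u v * low S v ≡ 0
        zero-term v with adjIn S u v in uv
        ... | false = refl
        ... | true  = trans (*-identityˡ _) (low≡0 S v (≰⇒> (low-independent u v uv deg≤2)))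

      discharge-∈ : ∀ u → u ∈ S → 12 + sent u ≤ deg S u * 5 + deg S u * low S u
      discharge-∈ u u∈ with ≤-<-connex (deg S u) 2
      ... | inj₁ deg≤2 = begin
        12 + sent u                 ≡⟨ cong (12 +_) (sends-nothing u deg≤2) ⟩
        -- A low vertex gains 1 per edge and pays nothing, so it holds 6 per edge on at least 2
        -- edges.
        12                              ≤⟨ *-monoˡ-≤ 6 (deg≥2 u u∈) ⟩
        deg S u * 6                     ≡⟨ *-distribˡ-+ (deg S u) 5 1 ⟩
        deg S u * 5 + deg S u * 1       ≡⟨ cong (λ l → deg S u * 5 + deg S u * l) (low≡1 S u deg≤2) ⟨
        deg S u * 5 + deg S u * low S u ∎
        where open ≤-Reasoning
      ... | inj₂ 3≤deg = begin
        -- A vertex of degree at least 3 keeps at least 4 per edge even if it pays along every edge.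
        12 + sent u                 ≤⟨ +-mono-≤ (*-monoˡ-≤ 4 3≤deg) (sent≤deg u) ⟩
        deg S u * 4 + deg S u           ≡⟨ +-comm (deg S u * 4) (deg S u) ⟩
        deg S u + deg S u * 4           ≡⟨ *-suc (deg S u) 4 ⟨
        deg S u * 5                     ≤⟨ m≤m+n _ _ ⟩
        deg S u * 5 + deg S u * low S u ∎
        where open ≤-Reasoning

      discharge : ∀ u b → lookup S u ≡ b → 12 * 𝟙 b + sent u ≤ deg S u * 5 + deg S u * low S u
      discharge u true  u∈ = discharge-∈ u (lookup⇒[]= u S u∈)
      -- Outside `S` no final charge is demanded; it is enough that a vertex does not pay more than
      -- it has.
      discharge u false _  = ≤-trans (sent≤deg u) (≤-trans (m≤m*n (deg S u) 5) (m≤m+n _ _))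

      -- Double counting of the pairs formed by a low vertex and a neighbour, using the symmetry of
      -- adjacency.
      received≡sent : sum (λ u → deg S u * low S u) ≡ sum sent
      received≡sent = begin
        sum (λ u → deg S u * low S u)               ≡⟨ sum-cong-≗ (λ u → cong (_* low S u) (deg≡sum S u)) ⟩
        sum (λ u → sum (a u) * low S u)             ≡⟨ sum-cong-≗ (λ u → *-distribʳ-sum (low S u) (a u)) ⟩
        sum (λ u → sum (λ v → a u v * low S u))     ≡⟨ ∑-comm (λ u v → a u v * low S u) ⟩
        sum (λ v → sum (λ u → a u v * low S u))     ≡⟨ sum-cong-≗ (λ v → sum-cong-≗ (λ u → cong (λ b → 𝟙 b * low S u) (adjIn-sym S u v))) ⟩
        sum sent                                ∎
        where open Relation.Binary.PropositionalEquality.≡-Reasoning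

    -- Summing `discharge` over all vertices, the total sent equals the total received and cancels;
    -- `handshake` converts the remaining degrees into edges.
    discharging : 12 * ∣ S ∣ ≤ (edgesIn G S + edgesIn G S) * 5
    discharging = +-cancelʳ-≤ (sum sent) _ _ (begin
      12 * ∣ S ∣ + sum sent                                    ≡⟨ cong (λ s → 12 * s + sum sent) (∣S∣≡sum S) ⟩
      12 * sum (λ u → 𝟙 (lookup S u)) + sum sent               ≡⟨ cong (_+ sum sent) (*-distribˡ-sum 12 (λ u → 𝟙 (lookup S u))) ⟩
      sum (λ u → 12 * 𝟙 (lookup S u)) + sum sent               ≡⟨ ∑-distrib-+ (λ u → 12 * 𝟙 (lookup S u)) sent ⟨
      sum (λ u → 12 * 𝟙 (lookup S u) + sent u)                 ≤⟨ sum-mono-≤ (λ u → discharge u _ refl) ⟩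
      sum (λ u → deg S u * 5 + deg S u * low S u)                  ≡⟨ ∑-distrib-+ (λ u → deg S u * 5) (λ u → deg S u * low S u) ⟩
      sum (λ u → deg S u * 5) + sum (λ u → deg S u * low S u)      ≡⟨ cong₂ _+_ (sym (*-distribʳ-sum 5 (deg S))) received≡sent ⟩
      sum (deg S) * 5 + sum sent                               ≡⟨ cong (λ s → s * 5 + sum sent) (handshake S) ⟩
      (edgesIn G S + edgesIn G S) * 5 + sum sent               ∎)
      where open ≤-Reasoning

  Reducible : Subset n → Set
  Reducible S = (∃ λ x → x ∈ S × deg S x ≤ 1)
              ⊎ (∃₂ λ x y → (x ∈ S × y ∈ S × Adj G x y ≡ true) × deg S x ≤ 2 × deg S y ≤ 2)

  -- Here `k` is ℓ - 1, so `k / (k ∸ 1)` is the density bound of the theorem. Both configurations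
  -- can be searched for, and the failure of the two searches supplies exactly the hypotheses of
  -- `discharging`.
  reducible : 7 ≤ k → mBelow G k (k ∸ 1) → ∀ S → Nonempty S → Reducible S
  reducible 7≤k below S S≢∅ with any? (λ x → (x ∈? S) ×-dec (deg S x ≤? 1))
  ... | yes leaf = inj₁ leaf
  ... | no ¬leaf with any? (λ x → any? (λ y → (adjIn S x y Bool.≟ true) ×-dec (deg S x ≤? 2) ×-dec (deg S y ≤? 2)))
  ...   | yes (x , y , xy , dx , dy) = inj₂ (x , y , adjIn⇒ S x y xy , dx , dy)
  ...   | no ¬pair = contradiction
            (discharging S (λ u u∈ → ≰⇒> (λ d → ¬leaf (u , u∈ , d))) (λ u v uv du dv → ¬pair (u , v , uv , du , dv)))
            (sparse⇒¬discharging {e = edgesIn G S} 7≤k (below S S≢∅))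

  nbr-unique : ∀ {S x a b} → deg S x ≤ 1 → x ∈ S → a ∈ S → b ∈ S → Adj G x a ≡ true → Adj G x b ≡ true → a ≡ b
  nbr-unique {a = a} {b} d x∈ a∈ b∈ xa xb =
    decidable-stable (a ≟ b) λ a≢b → <⇒≱ (two-members⇒2≤∣p∣ (∈-nbrs x∈ a∈ xa) (∈-nbrs x∈ b∈ xb) a≢b) d

  -- Otherwise `a`, `b` and `y` would be three distinct neighbours. With `a` and `b` the neighbours
  -- of `x` on a cycle, this forces the cycle to use the edge `xy`.
  one-of-two-nbrs : ∀ {S x y a b} → deg S x ≤ 2 → x ∈ S → y ∈ S → a ∈ S → b ∈ S →
                    Adj G x y ≡ true → Adj G x a ≡ true → Adj G x b ≡ true → a ≢ b → a ≡ y ⊎ b ≡ y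
  one-of-two-nbrs {y = y} {a} {b} d x∈ y∈ a∈ b∈ xy xa xb a≢b with a ≟ y | b ≟ y
  ... | yes a≡y | _       = inj₁ a≡y
  ... | no _    | yes b≡y = inj₂ b≡y
  ... | no a≢y  | no b≢y  = contradiction d
        (<⇒≱ (three-members⇒3≤∣p∣ (∈-nbrs x∈ a∈ xa) (∈-nbrs x∈ b∈ xb) (∈-nbrs x∈ y∈ xy) a≢b a≢y b≢y))

  -- Three-colouring

  ProperOn : Subset n → (Fin n → Fin 3) → Set
  ProperOn S c = ∀ u v → u ∈ S → v ∈ S → Adj G u v ≡ true → c u ≢ c v

  -- If every colour occurred among the neighbours of `x` in `S`, representatives of the three
  -- colours would be distinct and `x` would have degree at least 3. So some colour is free for `x`.
  extend-colouring : ∀ S x → x ∈ S → deg S x ≤ 2 → ∃ (ProperOn (S - x)) → ∃ (ProperOn S)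
  extend-colouring S x x∈ d (c , proper) = c′ , proper′
    where
    Used : Fin 3 → Set
    Used i = ∃ λ v → (v ∈ S) × (Adj G x v ≡ true) × (c v ≡ i)

    used? : ∀ i → Dec (Used i)
    used? i = any? (λ v → (v ∈? S) ×-dec (Adj G x v Bool.≟ true) ×-dec (c v ≟ i))

    ¬all-used : ¬ (∀ i → Used i)
    ¬all-used used with used zero | used (suc zero) | used (suc (suc zero))
    ... | u , u∈ , xu , cu | v , v∈ , xv , cv | w , w∈ , xw , cw =
      contradiction d (<⇒≱ (three-members⇒3≤∣p∣ (∈-nbrs x∈ u∈ xu) (∈-nbrs x∈ v∈ xv) (∈-nbrs x∈ w∈ xw)
        (λ { refl → contradiction (trans (sym cu) cv) λ () })
        (λ { refl → contradiction (trans (sym cu) cw) λ () })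
        (λ { refl → contradiction (trans (sym cv) cw) λ () })))

    free : ∃ λ i → ¬ Used i
    free = ¬∀⟶∃¬ 3 Used used? ¬all-used

    c′ : Fin n → Fin 3
    c′ v = if does (v ≟ x) then proj₁ free else c v

    proper′ : ProperOn S c′
    proper′ u v u∈ v∈ uv with u ≟ x | v ≟ x
    ... | yes refl | yes refl = contradiction refl (adj⇒≢ uv)
    ... | yes refl | no v≢x   = λ e → proj₂ free (v , v∈ , uv , sym e)
    ... | no u≢x   | yes refl = λ e → proj₂ free (u , u∈ , adj-sym uv , e)
    ... | no u≢x   | no v≢x   = proper u v (x∈p∧x≢y⇒x∈p-y u∈ u≢x) (x∈p∧x≢y⇒x∈p-y v∈ v≢x) uv

  -- Either reducible configuration provides a vertex of degree at most 2; from a pair only the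
  -- first vertex is deleted.
  three-colourable : (∀ S → Nonempty S → Reducible S) → ∀ S → ∃ (ProperOn S)
  three-colourable red = ∣∣-induction (∃ ∘ ProperOn) step
    where
    step : ∀ S → (∀ S′ → ∣ S′ ∣ < ∣ S ∣ → ∃ (ProperOn S′)) → ∃ (ProperOn S)
    step S ih with nonempty? S
    ... | no S≡∅ = (λ _ → zero) , λ u v u∈ → contradiction (u , u∈) S≡∅
    ... | yes S≢∅ with red S S≢∅
    ...   | inj₁ (x , x∈ , d) = extend-colouring S x x∈ (≤-trans d (n≤1+n 1)) (ih _ (x∈p⇒∣p-x∣<∣p∣ x∈))
    ...   | inj₂ (x , _ , (x∈ , _) , d , _) = extend-colouring S x x∈ d (ih _ (x∈p⇒∣p-x∣<∣p∣ x∈))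

-- The cyclic successor

toℕ-next : (i : Fin (suc k)) → toℕ (next i) ≡ suc (toℕ i) % suc k
toℕ-next {k} i = toℕ-fromℕ< (m%n<n (suc (toℕ i)) (suc k))

next-cases : (i : Fin (suc k)) → (toℕ (next i) ≡ suc (toℕ i)) ⊎ (toℕ i ≡ k × toℕ (next i) ≡ 0)
next-cases {k} i with m≤n⇒m<n∨m≡n (toℕ<n i)
... | inj₁ lt = inj₁ (trans (toℕ-next i) (m<n⇒m%n≡m lt))
... | inj₂ eq = inj₂ (suc-injective eq , trans (toℕ-next i) (trans (cong (_% suc k) eq) (n%n≡0 (suc k))))

-- Stands in for a predecessor function: rewriting an index as `next j` exposes both cycle edges at
-- it.
next-surjective : (i : Fin (suc k)) → ∃ λ j → next j ≡ i
next-surjective {k} zero = fromℕ k , toℕ-injective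
  (trans (toℕ-next (fromℕ k)) (trans (cong (λ m → suc m % suc k) (toℕ-fromℕ k)) (n%n≡0 (suc k))))
next-surjective {suc k} (suc i) = inject₁ i , toℕ-injective
  (trans (toℕ-next (inject₁ i))
    (trans (cong (λ m → suc m % suc (suc k)) (toℕ-inject₁ i)) (m<n⇒m%n≡m (s≤s (toℕ<n i)))))

-- The two cycle neighbours of a vertex differ once ℓ ≥ 3. Without wrap-around the index grows by 2;
-- one wrap forces k = 1, and two wraps force k = 0.
next²≢id : 2 ≤ k → (i : Fin (suc k)) → i ≢ next (next i)
next²≢id 2≤k i e with next-cases i | next-cases (next i) | cong toℕ e
... | inj₁ p       | inj₁ q       | r = contradiction (trans r (trans q (cong suc p))) (<⇒≢ (m<n⇒m<1+n (n<1+n _)))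
... | inj₁ p       | inj₂ (q , s) | r = contradiction (trans (sym q) (trans p (cong suc (trans r s)))) (>⇒≢ 2≤k)
... | inj₂ (p , t) | inj₁ q       | r = contradiction (trans (sym p) (trans r (trans q (cong suc t)))) (>⇒≢ 2≤k)
... | inj₂ (p , t) | inj₂ (q , s) | r = contradiction (trans (sym q) t) (>⇒≢ (<⇒≤ 2≤k))

-- Orientations from Boolean relations

∧-trueˡ : ∀ {a b} → a ∧ b ≡ true → a ≡ true
∧-trueˡ {true} _ = refl

∧-trueʳ : ∀ {a b} → a ∧ b ≡ true → b ≡ true
∧-trueʳ {true} h = h

module _ (G : Graph n) where

  -- Values off the edges are left free and masked by `orient`, so an orientation can be redefined
  -- near a vertex without regard to non-edges.
  FlipsOnEdges : (Fin n → Fin n → Bool) → Set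
  FlipsOnEdges t = ∀ u v → Adj G u v ≡ true → t v u ≡ not (t u v)

  orient : (t : Fin n → Fin n → Bool) → FlipsOnEdges t → Orientation G
  orient t flips = record
    { Arc     = λ u v → Adj G u v ∧ t u v
    ; onEdges = λ u v → ∧-trueˡ
    ; covers  = cover
    ; antisym = anti
    }
    where
    cover : ∀ u v → Adj G u v ≡ true → (Adj G u v ∧ t u v ≡ true) ⊎ (Adj G v u ∧ t v u ≡ true)
    cover u v uv rewrite adj-sym G uv | uv | flips u v uv with t u v
    ... | true  = inj₁ refl
    ... | false = inj₂ refl
    anti : ∀ u v → Adj G u v ∧ t u v ≡ true → Adj G v u ∧ t v u ≡ true → ⊥
    anti u v p q with trans (sym (∧-trueʳ {Adj G v u} q)) (trans (flips u v (∧-trueˡ p)) (cong not (∧-trueʳ {Adj G u v} p)))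
    ... | ()

  -- Copies are localised to `S` so that vertices can be deleted inductively. As `t` flips on edges,
  -- one equation per edge covers both values of `d`; adjacency is recorded separately because `t`
  -- ignores it.
  record CycleIn (t : Fin n → Fin n → Bool) (d : CycleOrientation (suc k)) (S : Subset n) : Set where
    constructor mkCycle
    field
      φ        : Fin (suc k) → Fin n
      inj      : Injective _≡_ _≡_ φ
      within   : ∀ i → φ i ∈ S
      adjacent : ∀ i → Adj G (φ i) (φ (next i)) ≡ true
      signs    : ∀ i → t (φ i) (φ (next i)) ≡ d i

  copy⇒cycle : ∀ t flips (d : CycleOrientation (suc k)) → CopyOfCycle {G = G} d (orient t flips) → CycleIn t d ⊤
  copy⇒cycle t flips d (φ , inj , arcs) =
    mkCycle φ inj (λ _ → ∈⊤) (λ i → proj₁ (both i)) (λ i → proj₂ (both i))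
    where
    both : ∀ i → Adj G (φ i) (φ (next i)) ≡ true × t (φ i) (φ (next i)) ≡ d i
    both i with d i | arcs i
    ... | true  | h = ∧-trueˡ h , ∧-trueʳ {Adj G (φ i) (φ (next i))} h
    -- Here the arc runs from `φ (next i)` to `φ i`, so its sign has to be flipped.
    ... | false | h = adj-sym G (∧-trueˡ h)
                    , trans (flips _ _ (∧-trueˡ h)) (cong not (∧-trueʳ {Adj G (φ (next i)) (φ i)} h))

-- Cycles containing a directed path with three edges

Monotone³ : CycleOrientation (suc k) → Set
Monotone³ d = ∃ λ i → d i ≡ d (next i) × d (next i) ≡ d (next (next i))

monotone³? : (d : CycleOrientation (suc k)) → Dec (Monotone³ d)
monotone³? d = any? (λ i → (d i Bool.≟ d (next i)) ×-dec (d (next i) Bool.≟ d (next (next i))))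

module _ (G : Graph n) (c : Fin n → Fin 3) (proper : ProperOn G ⊤ c) where

  ascending : Fin n → Fin n → Bool
  ascending u v = toℕ (c u) <ᵇ toℕ (c v)

  ascending-flips : FlipsOnEdges G ascending
  ascending-flips u v uv = <ᵇ-flip (toℕ (c u)) (toℕ (c v)) (proper u v ∈⊤ ∈⊤ uv ∘ toℕ-injective)

  ascending⇒< : ∀ {u v} → ascending u v ≡ true → toℕ (c u) < toℕ (c v)
  ascending⇒< h = <ᵇ⇒< _ _ (Equivalence.from T-≡ h)

  -- Four strictly increasing colours do not fit among three.
  no-ascending³ : ∀ {u v w x} → ascending u v ≡ true → ascending v w ≡ true → ascending w x ≡ true → ⊥
  no-ascending³ {x = x} p q r =
    <⇒≱ (toℕ<n (c x)) (≤-trans (s≤s (≤-trans (s≤s (≤-trans (s≤s z≤n) (ascending⇒< p))) (ascending⇒< q))) (ascending⇒< r))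

  no-monotone³-cycle : {d : CycleOrientation (suc k)} → Monotone³ d → ∀ {S} → ¬ CycleIn G ascending d S
  no-monotone³-cycle {d = d} (i , e₁ , e₂) (mkCycle φ inj within adj pat) with d i in di
  ... | true = no-ascending³ (trans (pat _) di) (trans (pat _) (sym e₁)) (trans (pat _) (sym (trans e₁ e₂)))
  -- The path is directed against the cycle, so it is read from its far end back to `φ i`.
  ... | false = no-ascending³ (back _ (sym (trans e₁ e₂))) (back _ (sym e₁)) (back _ di)
    where
    back : ∀ j → d j ≡ false → ascending (φ (next j)) (φ j) ≡ true
    back j dj = trans (ascending-flips _ _ (adj j)) (cong not (trans (pat j) dj))

-- Extending an orientation to two adjacent vertices of degree two

module _ (G : Graph n) (x y : Fin n) where

  -- Edges at `x` enter it, except that `xy` leaves it; all other edges at `y` leave `y`. Pairs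
  -- containing `x` are settled first, so the rows for `y` never touch `xy`.
  through : (Fin n → Fin n → Bool) → Fin n → Fin n → Bool
  through t u v with u ≟ x | v ≟ x | u ≟ y | v ≟ y
  ... | yes _ | _     | _     | v≟y   = does v≟y
  ... | no _  | yes _ | u≟y   | _     = not (does u≟y)
  ... | no _  | no _  | yes _ | _     = true
  ... | no _  | no _  | no _  | yes _ = false
  ... | no _  | no _  | no _  | no _  = t u v

  through-flips : ∀ {t} → FlipsOnEdges G t → FlipsOnEdges G (through t)
  through-flips flips u v uv with u ≟ x | v ≟ x | u ≟ y | v ≟ y
  ... | yes refl | yes refl | _        | _        = contradiction refl (adj⇒≢ G uv)
  ... | yes _    | no _     | _        | _        = refl
  ... | no _     | yes _    | _        | _        = sym (not-involutive _)
  ... | no _     | no _     | yes refl | yes refl = contradiction refl (adj⇒≢ G uv)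
  ... | no _     | no _     | yes _    | no _     = refl
  ... | no _     | no _     | no _     | yes _    = refl
  ... | no _     | no _     | no _     | no _     = flips u v uv

  through-x : ∀ t u → u ≢ x → u ≢ y → through t u x ≡ true
  through-x t u u≢x u≢y with u ≟ x | x ≟ x | u ≟ y | x ≟ y
  ... | yes u≡x | _     | _       | _ = contradiction u≡x u≢x
  ... | no _    | no x≢x | _      | _ = contradiction refl x≢x
  ... | no _    | yes _ | yes u≡y | _ = contradiction u≡y u≢y
  ... | no _    | yes _ | no _    | _ = refl

  through-xy : ∀ t → through t x y ≡ true
  through-xy t with x ≟ x | y ≟ x | x ≟ y | y ≟ y
  ... | no x≢x | _ | _ | _      = contradiction refl x≢x
  ... | yes _  | _ | _ | no y≢y = contradiction refl y≢y
  ... | yes _  | _ | _ | yes _  = refl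

  through-y : ∀ t v → x ≢ y → v ≢ x → through t y v ≡ true
  through-y t v x≢y v≢x with y ≟ x | v ≟ x | y ≟ y | v ≟ y
  ... | yes y≡x | _       | _      | _ = contradiction (sym y≡x) x≢y
  ... | no _    | yes v≡x | _      | _ = contradiction v≡x v≢x
  ... | no _    | no _    | no y≢y | _ = contradiction refl y≢y
  ... | no _    | no _    | yes _  | _ = refl

  through-elsewhere : ∀ t u v → u ≢ x → u ≢ y → v ≢ x → v ≢ y → through t u v ≡ t u v
  through-elsewhere t u v u≢x u≢y v≢x v≢y with u ≟ x | v ≟ x | u ≟ y | v ≟ y
  ... | yes u≡x | _       | _       | _       = contradiction u≡x u≢x
  ... | no _    | yes v≡x | _       | _       = contradiction v≡x v≢x
  ... | no _    | no _    | yes u≡y | _       = contradiction u≡y u≢y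
  ... | no _    | no _    | no _    | yes v≡y = contradiction v≡y v≢y
  ... | no _    | no _    | no _    | no _    = refl

-- Avoiding cycles that contain no directed path with three edges

module _ (G : Graph n) (2≤k : 2 ≤ k) (d : CycleOrientation (suc k)) (¬mono : ¬ Monotone³ d) where

  Avoiding : Subset n → Set
  Avoiding S = ∃ λ t → FlipsOnEdges G t × ¬ CycleIn G t d S

  -- The relation is kept: a cycle through `x` would give it two distinct neighbours in `S`.
  extend-leaf : ∀ S x → deg G S x ≤ 1 → Avoiding (S - x) → Avoiding S
  extend-leaf S x deg≤1 (t , flips , ¬cycle) = t , flips , ¬cycle′
    where
    ¬cycle′ : ¬ CycleIn G t d S
    ¬cycle′ (mkCycle φ inj within adj pat) =
      ¬cycle (mkCycle φ inj (λ i → x∈p∧x≢y⇒x∈p-y (within i) (avoids i)) adj pat)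
      where
      avoids : ∀ i → φ i ≢ x
      avoids i refl with next-surjective i
      ... | j , refl = next²≢id 2≤k j (inj
        (nbr-unique G deg≤1 (within _) (within j) (within (next (next j))) (adj-sym G (adj j)) (adj (next j))))

  -- By the degree bounds a cycle through `x` or `y` uses the edge `xy`. Together with the cycle
  -- edges before and after, it forms a directed path with three edges, against `¬mono`. Every other
  -- cycle lies in the smaller set, where `through` agrees with `t`.
  extend-pair : ∀ S x y → x ∈ S → y ∈ S → Adj G x y ≡ true → deg G S x ≤ 2 → deg G S y ≤ 2 →
                Avoiding ((S - x) - y) → Avoiding S
  extend-pair S x y x∈ y∈ xy dx dy (t , flips , ¬cycle) = t′ , flips′ , ¬cycle′
    where
    t′ = through G x y t
    flips′ = through-flips G x y flips
    x≢y = adj⇒≢ G xy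

    ¬cycle′ : ¬ CycleIn G t′ d S
    ¬cycle′ (mkCycle φ inj within adj pat) =
      ¬cycle (mkCycle φ inj
        (λ i → x∈p∧x≢y⇒x∈p-y (x∈p∧x≢y⇒x∈p-y (within i) (avoids-x i)) (avoids-y i)) adj
        (λ i → trans (sym (through-elsewhere G x y t _ _ (avoids-x i) (avoids-y i) (avoids-x _) (avoids-y _))) (pat i)))
      where
      φ-next²≢ : ∀ i → φ i ≢ φ (next (next i))
      φ-next²≢ i = next²≢id 2≤k i ∘ inj

      -- The monotone triple starts one index before `i`, at the edge entering `x`. The vertices
      -- before `x` and after `y` are not `y` and `x` respectively, by `φ-next²≢`.
      ¬forward : ∀ i → φ i ≡ x → φ (next i) ≡ y → ⊥
      ¬forward i φi≡x φi′≡y with next-surjective i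
      ... | j , refl = ¬mono (j , trans dj (sym di) , trans di (sym di′))
        where
        dj : d j ≡ true
        dj = trans (sym (pat j)) (subst (λ v → t′ (φ j) v ≡ true) (sym φi≡x)
               (through-x G x y t (φ j) (λ e → adj⇒≢ G (adj j) (trans e (sym φi≡x)))
                                        (λ e → φ-next²≢ j (trans e (sym φi′≡y)))))
        di : d (next j) ≡ true
        di = trans (sym (pat (next j))) (trans (cong₂ t′ φi≡x φi′≡y) (through-xy G x y t))
        di′ : d (next (next j)) ≡ true
        di′ = trans (sym (pat _)) (subst (λ u → t′ u (φ (next (next (next j)))) ≡ true) (sym φi′≡y)
                (through-y G x y t _ x≢y (λ e → φ-next²≢ (next j) (trans φi≡x (sym e)))))

      -- The same path met against the direction of the cycle, so the three signs are all `false`.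
      ¬backward : ∀ i → φ i ≡ y → φ (next i) ≡ x → ⊥
      ¬backward i φi≡y φi′≡x with next-surjective i
      ... | j , refl = ¬mono (j , trans dj (sym di) , trans di (sym di′))
        where
        flip : ∀ i → t′ (φ (next i)) (φ i) ≡ true → d i ≡ false
        flip i h = trans (sym (pat i)) (trans (flips′ _ _ (adj-sym G (adj i))) (cong not h))
        dj : d j ≡ false
        dj = flip j (subst (λ u → t′ u (φ j) ≡ true) (sym φi≡y)
               (through-y G x y t _ x≢y (λ e → φ-next²≢ j (trans e (sym φi′≡x)))))
        di : d (next j) ≡ false
        di = flip (next j) (trans (cong₂ t′ φi′≡x φi≡y) (through-xy G x y t))
        di′ : d (next (next j)) ≡ false
        di′ = flip _ (subst (λ v → t′ (φ (next (next (next j)))) v ≡ true) (sym φi′≡x)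
                (through-x G x y t _ (λ e → adj⇒≢ G (adj (next (next j))) (trans φi′≡x (sym e)))
                                     (λ e → φ-next²≢ (next j) (trans φi≡y (sym e)))))

      avoids-x : ∀ i → φ i ≢ x
      avoids-x i φi≡x with next-surjective i
      avoids-x _ refl | j , refl with
        one-of-two-nbrs G dx x∈ y∈ (within j) (within _) xy (adj-sym G (adj j)) (adj (next j)) (φ-next²≢ j)
      ... | inj₁ φj≡y = ¬backward j φj≡y refl
      ... | inj₂ φj″≡y = ¬forward (next j) refl φj″≡y

      -- One cycle neighbour of `y` would be `x`, which `avoids-x` has already excluded.
      avoids-y : ∀ i → φ i ≢ y
      avoids-y i φi≡y with next-surjective i
      avoids-y _ refl | j , refl with
        one-of-two-nbrs G dy y∈ x∈ (within j) (within _) (adj-sym G xy) (adj-sym G (adj j)) (adj (next j)) (φ-next²≢ j)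
      ... | inj₁ φj≡x = avoids-x j φj≡x
      ... | inj₂ φj″≡x = avoids-x _ φj″≡x

  avoiding : (∀ S → Nonempty S → Reducible G S) → ∀ S → Avoiding S
  avoiding red = ∣∣-induction Avoiding step
    where
    step : ∀ S → (∀ S′ → ∣ S′ ∣ < ∣ S ∣ → Avoiding S′) → Avoiding S
    step S ih with nonempty? S
    -- Orientation by vertex numbers serves as the default; a cycle would put `φ zero` into the
    -- empty set.
    ... | no S≡∅ = (λ u v → toℕ u <ᵇ toℕ v)
                 , (λ u v uv → <ᵇ-flip (toℕ u) (toℕ v) (adj⇒≢ G uv ∘ toℕ-injective))
                 , (λ Z → S≡∅ (CycleIn.φ Z zero , CycleIn.within Z zero))
    ... | yes S≢∅ with red S S≢∅
    ...   | inj₁ (x , x∈ , d≤1) = extend-leaf S x d≤1 (ih _ (x∈p⇒∣p-x∣<∣p∣ x∈))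
    ...   | inj₂ (x , y , (x∈ , y∈ , xy) , dx , dy) = extend-pair S x y x∈ y∈ xy dx dy
              -- Deleting `x` already shrinks `S` strictly, so for `y` a weak inequality suffices.
              (ih _ (≤-<-trans (∣p─q∣≤∣p∣ (S - x) _) (x∈p⇒∣p-x∣<∣p∣ x∈)))

theorem16 : (k : ℕ) → 8 ≤ suc k → (d : CycleOrientation (suc k)) →
    (n : ℕ) (G : Graph n) → mBelow G (m₂num (suc k)) (m₂den (suc k)) →
    Σ (Orientation G) λ O → ¬ CopyOfCycle {G = G} d O
theorem16 k 8≤ℓ d n G below with monotone³? d
... | yes mono with three-colourable G (reducible G (s≤s⁻¹ 8≤ℓ) below) ⊤
...   | c , proper = orient G (ascending G c proper) (ascending-flips G c proper)
                   , no-monotone³-cycle G c proper mono ∘ copy⇒cycle G _ _ d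
theorem16 k 8≤ℓ d n G below | no ¬mono
  with avoiding G (≤-trans (s≤s (s≤s z≤n)) (s≤s⁻¹ 8≤ℓ)) d ¬mono (reducible G (s≤s⁻¹ 8≤ℓ) below) ⊤
... | t , flips , ¬cycle = orient G t flips , ¬cycle ∘ copy⇒cycle G t flips d
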